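{- Assume $n$ is even. A line $\ell$ of $\mathrm{PG}(n-1,q)$ has the property that $j(\ell)$ is a line if and only if $\ell\in\mathcal D$. Equivalently, for distinct points $Fa,Fb$, the image under $j$ of the line through $Fa$ and $Fb$ is a line if and only if $F(ab^{ -1})=C$.
   Context: Let $q$ be a prime power, $F=\mathbb F_q$, $n\ge 2$ an integer, and $L=\mathbb F_{q^n}\supseteq F$. Regard $L$ as an $n$-dimensional $F$-vector space; $\mathrm{PG}(n-1,q)$ denotes the projective space whose points are the one-dimensional $F$-subspaces $Fx$, $x\in L^*$, and whose lines are the two-dimensional $F$-subspaces (identified with their sets of points). Define $j:\mathrm{PG}(n-1,q)\to\mathrm{PG}(n-1,q)$ by $j(Fx)=Fx^{ -1}$. When $n$ is even, $C$ denotes the unique subfield of $L$ of order $q^2$; for $x\in L^*$, $Cx$ is a two-dimensional $F$-subspace of $L$, regarded as a line of $\mathrm{PG}(n-1,q)$, and $\mathcal D=\{Cx: x\in L^*\}$ is the Desarguesian line spread. -}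

module Defs where

open import Level using (Level; _⊔_) renaming (suc to lsuc)
open import Data.Nat.Base using (ℕ; _^_; _≤_)
open import Data.Nat.Primality using (Prime)
open import Data.Fin.Base using (Fin)
open import Data.Product using (∃-syntax; _×_; _,_; proj₁; proj₂)
open import Function.Bundles using (Inverse)
open import Relation.Binary.Bundles using (Setoid)
open import Relation.Binary.PropositionalEquality using (_≡_) renaming (setoid to ≡-setoid)
import Relation.Binary.Construct.On as On
import Relation.Binary.Reasoning.Setoid as SetoidReasoning
open import Relation.Nullary using (¬_)
open import Relation.Unary using (Pred; _∈_; _⊆_; _≐_)
open import Algebra.Bundles using (CommutativeRing)
open import Algebra.Apartness.Bundles using (HeytingCommutativeRing; HeytingField)
import Algebra.Apartness.Properties.HeytingCommutativeRing as HCRProperties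
import Algebra.Properties.Ring as RingProperties

IsPrimePower : ℕ → Set
IsPrimePower q = ∃[ p ] ∃[ k ] (Prime p × 1 ≤ k × q ≡ p ^ k)

HasOrder : ∀ {a ℓ} → Setoid a ℓ → ℕ → Set (a ⊔ ℓ)
HasOrder S m = Inverse S (≡-setoid (Fin m))

-- In a HeytingField, x # y means that x - y is invertible.  When the field is
-- finite, _≈_ is decidable and x # y is equivalent to ¬ (x ≈ y), so
-- { x | x # 0# } is the set L* of nonzero elements.
module _ {c ℓ₁ ℓ₂ : Level} (L : HeytingField c ℓ₁ ℓ₂) where

  open HeytingField L

  record Subfield (f : Level) : Set (c ⊔ ℓ₁ ⊔ lsuc f) where
    field
      elements  : Pred Carrier f
      resp-≈    : ∀ {x y} → x ≈ y → x ∈ elements → y ∈ elements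
      0-closed  : 0# ∈ elements
      1-closed  : 1# ∈ elements
      +-closed  : ∀ {x y} → x ∈ elements → y ∈ elements → (x + y) ∈ elements
      neg-closed : ∀ {x} → x ∈ elements → (- x) ∈ elements
      *-closed  : ∀ {x y} → x ∈ elements → y ∈ elements → (x * y) ∈ elements
      inv-closed : ∀ {x y} → x * y ≈ 1# → x ∈ elements → y ∈ elements

    subsetoid : Setoid (c ⊔ f) ℓ₁
    subsetoid = On.setoid setoid (proj₁ {B = elements})

module PG {c ℓ₁ ℓ₂ f : Level} (L : HeytingField c ℓ₁ ℓ₂) (F : Subfield L f) where

  open HeytingField L
  open Subfield F
  open HCRProperties heytingCommutativeRing using (x-0≈x; invertibleʳ⇒#)
  private
    module R = CommutativeRing (HeytingCommutativeRing.commutativeRing heytingCommutativeRing)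
  open RingProperties R.ring using (-‿distribˡ-*)
  open SetoidReasoning R.setoid

  inv : (x : Carrier) → x # 0# → Carrier
  inv x x#0 = proj₁ (#⇒invertible x#0)

  inv-inverseʳ : ∀ x (x#0 : x # 0#) → x * inv x x#0 ≈ 1#
  inv-inverseʳ x x#0 =
    trans (*-congʳ (sym (x-0≈x x))) (proj₂ (proj₂ (#⇒invertible x#0)))

  inv-inverseˡ : ∀ x (x#0 : x # 0#) → inv x x#0 * x ≈ 1#
  inv-inverseˡ x x#0 = trans (*-comm _ _) (inv-inverseʳ x x#0)

  inv#0 : ∀ x (x#0 : x # 0#) → inv x x#0 # 0#
  inv#0 x x#0 = invertibleʳ⇒#
    (x , trans (*-congʳ (x-0≈x _)) (inv-inverseˡ x x#0))

  infix 8 _·_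
  _·_ : ∀ {s} → Pred Carrier s → Carrier → Pred Carrier (c ⊔ ℓ₁ ⊔ s)
  (S · x) y = ∃[ s ] (s ∈ S × y ≈ s * x)

  -- The point F x is given by a representative x ∈ L*; equality of points
  -- is _≈ₚ_, equality of the subspaces F x.
  record Point : Set (c ⊔ ℓ₂) where
    constructor point
    field
      rep   : Carrier
      rep#0 : rep # 0#

    subspace : Pred Carrier (c ⊔ ℓ₁ ⊔ f)
    subspace = elements · rep

  open Point public using (rep; rep#0)

  infix 4 _≈ₚ_
  _≈ₚ_ : Point → Point → Set (c ⊔ ℓ₁ ⊔ f)
  P ≈ₚ Q = Point.subspace P ≐ Point.subspace Q

  j : Point → Point
  j (point x x#0) = point (inv x x#0) (inv#0 x x#0)

  span : Carrier → Carrier → Pred Carrier (c ⊔ ℓ₁ ⊔ f)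
  span a b y = ∃[ s ] ∃[ t ] (s ∈ elements × t ∈ elements × y ≈ s * a + t * b)

  Independent : Carrier → Carrier → Set (c ⊔ ℓ₁ ⊔ f)
  Independent a b = ∀ {s t} → s ∈ elements → t ∈ elements →
    s * a + t * b ≈ 0# → s ≈ 0# × t ≈ 0#

  record IsSubspace {u} (U : Pred Carrier u) : Set (c ⊔ ℓ₁ ⊔ f ⊔ u) where
    field
      respects : ∀ {x y} → x ≈ y → x ∈ U → y ∈ U
      0-mem    : 0# ∈ U
      +-mem    : ∀ {x y} → x ∈ U → y ∈ U → (x + y) ∈ U
      scale    : ∀ {s x} → s ∈ elements → x ∈ U → (s * x) ∈ U

  record Line : Set (lsuc (c ⊔ ℓ₁ ⊔ f)) where
    field
      vectors    : Pred Carrier (c ⊔ ℓ₁ ⊔ f)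
      isSubspace : IsSubspace vectors
      basis      : ∃[ a ] ∃[ b ] (Independent a b × vectors ≐ span a b)

    points : Pred Point (c ⊔ ℓ₁ ⊔ f)
    points P = Point.subspace P ⊆ vectors

  jImage : Line → Pred Point (c ⊔ ℓ₁ ⊔ ℓ₂ ⊔ f)
  jImage ℓ P = ∃[ Q ] (Q ∈ Line.points ℓ × P ≈ₚ j Q)

  IsLine : ∀ {s} → Pred Point s → Set (lsuc (c ⊔ ℓ₁ ⊔ f) ⊔ ℓ₂ ⊔ s)
  IsLine S = ∃[ ℓ ] (S ≐ Line.points ℓ)

  -- { C x | x ∈ L* }, where C is intended to be the subfield of order q².
  DesarguesianSpread : ∀ {k} → Subfield L k → Pred Line (c ⊔ ℓ₁ ⊔ ℓ₂ ⊔ f ⊔ k)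
  DesarguesianSpread C ℓ =
    ∃[ x ] (x # 0# × Line.vectors ℓ ≐ Subfield.elements C · x)

  -- The subfield F(α) of L generated by F and α.
  data Adjoin (α : Carrier) : Pred Carrier (c ⊔ ℓ₁ ⊔ f) where
    base : ∀ {x} → x ∈ elements → Adjoin α x
    gen  : Adjoin α α
    resp : ∀ {x y} → x ≈ y → Adjoin α x → Adjoin α y
    add  : ∀ {x y} → Adjoin α x → Adjoin α y → Adjoin α (x + y)
    neg  : ∀ {x} → Adjoin α x → Adjoin α (- x)
    mul  : ∀ {x y} → Adjoin α x → Adjoin α y → Adjoin α (x * y)
    recip : ∀ {x y} → x * y ≈ 1# → Adjoin α x → Adjoin α y

  ratio : Point → Point → Carrier
  ratio (point a _) (point b b#0) = a * inv b b#0

  private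
    inv-scalar : ∀ {s x y} (x#0 : x # 0#) (y#0 : y # 0#) → x ≈ s * y →
                 inv y y#0 ≈ s * inv x x#0
    inv-scalar {s} {x} {y} x#0 y#0 x≈sy = begin
      inv y y#0                          ≈⟨ *-identityʳ _ ⟨
      inv y y#0 * 1#                     ≈⟨ *-congˡ (inv-inverseʳ x x#0) ⟨
      inv y y#0 * (x * inv x x#0)        ≈⟨ *-assoc _ _ _ ⟨
      (inv y y#0 * x) * inv x x#0        ≈⟨ *-congʳ (*-congˡ x≈sy) ⟩
      (inv y y#0 * (s * y)) * inv x x#0  ≈⟨ *-congʳ (*-congˡ (*-comm s y)) ⟩
      (inv y y#0 * (y * s)) * inv x x#0  ≈⟨ *-congʳ (*-assoc _ _ _) ⟨
      ((inv y y#0 * y) * s) * inv x x#0  ≈⟨ *-congʳ (*-congʳ (inv-inverseˡ y y#0)) ⟩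
      (1# * s) * inv x x#0               ≈⟨ *-congʳ (*-identityˡ s) ⟩
      s * inv x x#0                      ∎

    ·-mono : ∀ {x y} → x ∈ elements · y → elements · x ⊆ elements · y
    ·-mono {x} {y} (s , s∈F , x≈sy) {z} (t , t∈F , z≈tx) =
      t * s , *-closed t∈F s∈F ,
      trans z≈tx (trans (*-congˡ x≈sy) (sym (*-assoc t s y)))

    ∈-own : ∀ x → x ∈ elements · x
    ∈-own x = 1# , 1-closed , sym (*-identityˡ x)

    invert-scalar : ∀ {x y s} → x # 0# → s ∈ elements → x ≈ s * y → y ∈ elements · x
    invert-scalar {x} {y} {s} x#0 s∈F x≈sy =
      u , inv-closed su≈1 s∈F , sym ux≈y
      where
      u = y * inv x x#0
      su≈1 : s * u ≈ 1#
      su≈1 = begin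
        s * (y * inv x x#0) ≈⟨ *-assoc _ _ _ ⟨
        (s * y) * inv x x#0 ≈⟨ *-congʳ x≈sy ⟨
        x * inv x x#0       ≈⟨ inv-inverseʳ x x#0 ⟩
        1#                  ∎
      ux≈y : u * x ≈ y
      ux≈y = trans (*-assoc _ _ _)
        (trans (*-congˡ (inv-inverseˡ x x#0)) (*-identityʳ y))

    -- The coefficient of a in a vanishing combination of a and b cannot be
    -- apart from 0#, for otherwise F a = F b.
    coefficient : ∀ {a b s t} → a # 0# → ¬ (elements · a ≐ elements · b) →
                  s ∈ elements → t ∈ elements → s * a + t * b ≈ 0# → s ≈ 0#
    coefficient {a} {b} {s} {t} a#0 Fa≠Fb s∈F t∈F eq = proj₁ (tight _ _) ¬s#0
      where
      ¬s#0 : ¬ (s # 0#)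
      ¬s#0 s#0 = Fa≠Fb
        ( ·-mono (r , r∈F , a≈rb)
        , ·-mono (invert-scalar a#0 r∈F a≈rb) )
        where
        i = inv s s#0
        r = i * (- t)
        r∈F : r ∈ elements
        r∈F = *-closed (inv-closed (inv-inverseʳ s s#0) s∈F) (neg-closed t∈F)
        sa≈-tb : s * a ≈ (- t) * b
        sa≈-tb = begin
          s * a                        ≈⟨ +-identityʳ _ ⟨
          s * a + 0#                   ≈⟨ +-congˡ (-‿inverseʳ (t * b)) ⟨
          s * a + (t * b + - (t * b))  ≈⟨ +-assoc _ _ _ ⟨
          (s * a + t * b) + - (t * b)  ≈⟨ +-congʳ eq ⟩
          0# + - (t * b)               ≈⟨ +-identityˡ _ ⟩
          - (t * b)                    ≈⟨ -‿distribˡ-* t b ⟩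
          (- t) * b                    ∎
        a≈rb : a ≈ r * b
        a≈rb = begin
          a                ≈⟨ *-identityˡ a ⟨
          1# * a           ≈⟨ *-congʳ (inv-inverseˡ s s#0) ⟨
          (i * s) * a      ≈⟨ *-assoc _ _ _ ⟩
          i * (s * a)      ≈⟨ *-congˡ sa≈-tb ⟩
          i * ((- t) * b)  ≈⟨ *-assoc _ _ _ ⟨
          r * b            ∎

  j-cong : ∀ P Q → P ≈ₚ Q → j P ≈ₚ j Q
  j-cong (point x x#0) (point y y#0) (Fx⊆Fy , Fy⊆Fx)
    with Fx⊆Fy (∈-own x) | Fy⊆Fx (∈-own y)
  ... | s , s∈F , x≈sy | t , t∈F , y≈tx =
    ·-mono (t , t∈F , inv-scalar y#0 x#0 y≈tx) ,
    ·-mono (s , s∈F , inv-scalar x#0 y#0 x≈sy)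

  span-isSubspace : ∀ a b → IsSubspace (span a b)
  span-isSubspace a b = record
    { respects = λ x≈y (s , t , s∈F , t∈F , eq) → s , t , s∈F , t∈F , trans (sym x≈y) eq
    ; 0-mem = 0# , 0# , 0-closed , 0-closed ,
        sym (trans (+-cong (zeroˡ a) (zeroˡ b)) (+-identityˡ 0#))
    ; +-mem = λ {x} {y} (s , t , s∈F , t∈F , x≈) (s′ , t′ , s′∈F , t′∈F , y≈) →
        s + s′ , t + t′ , +-closed s∈F s′∈F , +-closed t∈F t′∈F ,
        (begin
          x + y                                ≈⟨ +-cong x≈ y≈ ⟩
          (s * a + t * b) + (s′ * a + t′ * b)  ≈⟨ +-assoc _ _ _ ⟩
          s * a + (t * b + (s′ * a + t′ * b))  ≈⟨ +-congˡ (+-assoc _ _ _) ⟨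
          s * a + ((t * b + s′ * a) + t′ * b)  ≈⟨ +-congˡ (+-congʳ (+-comm _ _)) ⟩
          s * a + ((s′ * a + t * b) + t′ * b)  ≈⟨ +-congˡ (+-assoc _ _ _) ⟩
          s * a + (s′ * a + (t * b + t′ * b))  ≈⟨ +-assoc _ _ _ ⟨
          (s * a + s′ * a) + (t * b + t′ * b)  ≈⟨ +-cong (distribʳ a s s′) (distribʳ b t t′) ⟨
          (s + s′) * a + (t + t′) * b          ∎)
    ; scale = λ {r} {x} r∈F (s , t , s∈F , t∈F , x≈) →
        r * s , r * t , *-closed r∈F s∈F , *-closed r∈F t∈F ,
        (begin
          r * x                      ≈⟨ *-congˡ x≈ ⟩
          r * (s * a + t * b)        ≈⟨ distribˡ r _ _ ⟩
          r * (s * a) + r * (t * b)  ≈⟨ +-cong (*-assoc r s a) (*-assoc r t b) ⟨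
          (r * s) * a + (r * t) * b  ∎)
    }

  distinct⇒independent : ∀ P Q → ¬ (P ≈ₚ Q) → Independent (rep P) (rep Q)
  distinct⇒independent (point a a#0) (point b b#0) P≠Q s∈F t∈F eq =
    coefficient a#0 P≠Q s∈F t∈F eq ,
    coefficient b#0 (λ (Fb⊆Fa , Fa⊆Fb) → P≠Q (Fa⊆Fb , Fb⊆Fa)) t∈F s∈F
      (trans (+-comm _ _) eq)

  lineThrough : (P Q : Point) → ¬ (P ≈ₚ Q) → Line
  lineThrough P Q P≠Q = record
    { vectors    = span (rep P) (rep Q)
    ; isSubspace = span-isSubspace (rep P) (rep Q)
    ; basis      = rep P , rep Q , distinct⇒independent P Q P≠Q ,
                   (λ m → m) , (λ m → m)
    }

-- Put α = a/b for a line ℓ = ⟨a, b⟩.  If j(ℓ) is a line, it is ⟨a⁻¹, b⁻¹⟩ and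
-- contains (a+b)⁻¹; clearing denominators in (a+b)⁻¹ = s a⁻¹ + t b⁻¹ gives
-- α = (s + tα)(1 + α) with t ≠ 0, so ⟨α, 1⟩ is closed under multiplication.  A
-- multiplicatively closed set of q² elements containing 0 consists of roots of
-- X^(q²) − X, as does C, which already accounts for all q² possible roots; hence
-- ⟨α, 1⟩ = C and ℓ = C b.  Conversely j maps C x onto C x⁻¹.

module Submission where

open import Defs
open import Data.Nat.Base using (ℕ; _^_; _≤_)
open import Data.Nat.Divisibility using (_∣_)
open import Data.Product using (_×_)
open import Function.Bundles using (_⇔_)
open import Relation.Nullary using (¬_)
open import Relation.Unary using (_∈_; _≐_)
open import Algebra.Apartness.Bundles using (HeytingField)

open import Level using (_⊔_)
open import Algebra.Apartness.Bundles using (HeytingCommutativeRing)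
import Algebra.Apartness.Properties.HeytingCommutativeRing as HeytingProperties
open import Algebra.Bundles using (CommutativeRing; CommutativeSemiring)
import Algebra.Properties.CommutativeMonoid.Sum as Sum
import Algebra.Properties.CommutativeSemigroup as CommutativeSemigroupProperties
import Algebra.Properties.Group as GroupProperties
import Algebra.Properties.Ring as RingProperties
import Algebra.Properties.Semiring.Exp as Exp
import Algebra.Solver.Ring.NaturalCoefficients.Default as SemiringSolver
open import Data.Fin.Base using (Fin; zero; suc; punchIn; punchOut; combine; remQuot)
open import Data.Fin.Permutation using (Permutation′; permutation)
import Data.Fin.Properties as Fin
open import Data.Nat.Base using (suc) renaming (_*_ to _*ℕ_)
import Data.Nat.Properties as ℕ
open import Data.Product using (∃-syntax; _,_; proj₁; proj₂)
open import Data.Sum.Base using (_⊎_; inj₁; inj₂)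
open import Data.Vec.Base using (Vec; []; _∷_; replicate)
open import Function.Base using (_∘_)
open import Function.Bundles using (Inverse; Injection; mk⇔)
open import Function.Definitions using (Congruent; Injective)
open import Function.Properties.Inverse using (Inverse⇒Injection)
open import Relation.Binary.Bundles using (Setoid)
import Relation.Binary.Construct.On as On
open import Relation.Binary.Definitions using (Decidable)
import Relation.Binary.Reasoning.Setoid as SetoidReasoning
open import Relation.Binary.PropositionalEquality as ≡ using (_≡_)
open import Relation.Nullary using (Dec; yes; no; contradiction)
open import Relation.Nullary.Decidable using (map′)
open import Relation.Unary using (Pred; _⊆_)

-- Injections between finite sets of equal size.

-- If `j` were missed, punching it out of the codomain would give an injection of `Fin (suc n)` into
-- `Fin n`.
injective⇒surjective : ∀ {n} {f : Fin n → Fin n} → Injective _≡_ _≡_ f →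
                       ∀ j → ∃[ i ] f i ≡ j
injective⇒surjective {suc n} {f} inj j with Fin.any? (λ i → f i Fin.≟ j)
... | yes hit = hit
... | no miss = contradiction (Fin.injective⇒≤ avoid-injective) ℕ.1+n≰n
  where
  avoid : Fin (suc n) → Fin n
  avoid i = punchOut (miss ∘ (i ,_) ∘ ≡.sym)

  avoid-injective : Injective _≡_ _≡_ avoid
  avoid-injective {i} {k} eq = inj (Fin.punchOut-injective (miss ∘ (i ,_) ∘ ≡.sym) (miss ∘ (k ,_) ∘ ≡.sym) eq)

injective⇒permutation : ∀ {n} {f : Fin n → Fin n} → Injective _≡_ _≡_ f → Permutation′ n
injective⇒permutation {f = f} inj = permutation f (proj₁ ∘ onto) (proj₂ ∘ onto)
  (λ i → inj (proj₂ (onto (f i))))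
  where
  onto = injective⇒surjective inj

module _ {a ℓ m} {S : Setoid a ℓ} (size : HasOrder S m) where
  open Setoid S
  open Inverse size

  to-injective : Injective _≈_ _≡_ to
  to-injective = Injection.injective (Inverse⇒Injection size)

  from-to : ∀ x → from (to x) ≈ x
  from-to x = inverseʳ ≡.refl

  to-from : ∀ i → to (from i) ≡ i
  to-from i = inverseˡ refl

  hasOrder⇒≟ : Decidable _≈_
  hasOrder⇒≟ x y = map′ to-injective to-cong (to x Fin.≟ to y)

injective⇒surjective-setoid :
  ∀ {a b ℓ ℓ′ m} {S : Setoid a ℓ} {T : Setoid b ℓ′} → HasOrder S m → HasOrder T m →
  {f : Setoid.Carrier S → Setoid.Carrier T} →
  Congruent (Setoid._≈_ S) (Setoid._≈_ T) f →
  Injective (Setoid._≈_ S) (Setoid._≈_ T) f → ∀ y → ∃[ x ] Setoid._≈_ T (f x) y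
injective⇒surjective-setoid {S = S} {T} sizeS sizeT {f} f-cong f-inj y =
  S′.from (proj₁ hit) , to-injective sizeT (proj₂ hit)
  where
  module S′ = Inverse sizeS
  module T′ = Inverse sizeT

  f′-inj : Injective _≡_ _≡_ (T′.to ∘ f ∘ S′.from)
  f′-inj {i} {k} eq = ≡.trans (≡.sym (to-from sizeS i))
    (≡.trans (S′.to-cong (f-inj (to-injective sizeT eq))) (to-from sizeS k))

  hit = injective⇒surjective f′-inj (T′.to y)

-- Commutative semiring identities.

-- Stated for an arbitrary semiring, because the normal forms computed by the
-- solver become very large when the operations are projections of L.
module SemiringIdentities {c ℓ} (S : CommutativeSemiring c ℓ) where
  open CommutativeSemiring S hiding (zero)
  open SemiringSolver S using (solve; _:=_; _:+_; _:*_)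

  -- A semiring has no subtraction, so `y` stands for x - r and `y + r` for x; likewise in
  -- `division-step`.
  linear-division : ∀ a y r z → a + (y + r) * z ≈ y * z + (a + r * z)
  linear-division = solve 4
    (λ a y r z → a :+ (y :+ r) :* z := y :* z :+ (a :+ r :* z)) refl

  division-step : ∀ a x y r q v →
    a + (x * (y * q) + (y + r) * v) ≈ y * (v + x * q) + (a + r * v)
  division-step = solve 6
    (λ a x y r q v → a :+ (x :* (y :* q) :+ (y :+ r) :* v)
                  := y :* (v :+ x :* q) :+ (a :+ r :* v)) refl

  scale-combination : ∀ e s t a b → s * (e * a) + t * (e * b) ≈ e * (s * a + t * b)
  scale-combination = solve 5
    (λ e s t a b → s :* (e :* a) :+ t :* (e :* b) := e :* (s :* a :+ t :* b)) refl

  add-combinations : ∀ s s′ t t′ a b →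
    (s + s′) * a + (t + t′) * b ≈ (s * a + t * b) + (s′ * a + t′ * b)
  add-combinations = solve 6
    (λ s s′ t t′ a b → (s :+ s′) :* a :+ (t :+ t′) :* b
                    := (s :* a :+ t :* b) :+ (s′ :* a :+ t′ :* b)) refl

  -- Meant for `a′` = a⁻¹ and `b′` = b⁻¹. The right side is grouped so that `a * a′` and `b * b′`
  -- can be replaced by 1 and everything else is expressed through α = `a * b′`.
  clear-denominators : ∀ a b a′ b′ s t →
    (a * b′) * ((s * a′ + t * b′) * (a + b)) ≈
    ((a * a′) * (s * (a * b′)) + s * ((a * a′) * (b * b′))) +
    (t * ((a * b′) * (a * b′)) + (b * b′) * (t * (a * b′)))
  clear-denominators = solve 6
    (λ a b a′ b′ s t → (a :* b′) :* ((s :* a′ :+ t :* b′) :* (a :+ b))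
       := ((a :* a′) :* (s :* (a :* b′)) :+ s :* ((a :* a′) :* (b :* b′)))
       :+ (t :* ((a :* b′) :* (a :* b′)) :+ (b :* b′) :* (t :* (a :* b′)))) refl

  multiply-linear : ∀ x s t s′ t′ →
    (s * x + t) * (s′ * x + t′) ≈ s * s′ * (x * x) + ((s * t′ + t * s′) * x + t * t′)
  multiply-linear = solve 5
    (λ x s t s′ t′ → (s :* x :+ t) :* (s′ :* x :+ t′)
                  := s :* s′ :* (x :* x) :+ ((s :* t′ :+ t :* s′) :* x :+ t :* t′)) refl

  collect-linear : ∀ x u v r w z →
    r * (u * x + v) + (w * x + z) ≈ (r * u + w) * x + (r * v + z)
  collect-linear = solve 6
    (λ x u v r w z → r :* (u :* x :+ v) :+ (w :* x :+ z)
                  := (r :* u :+ w) :* x :+ (r :* v :+ z)) refl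

-- Decidability, cancellation and subsets in a finite field.

module FiniteField {c ℓ₁ ℓ₂} (L : HeytingField c ℓ₁ ℓ₂)
                   {N} (sizeL : HasOrder (HeytingField.setoid L) N) where

  open HeytingField L hiding (zero)
  open HeytingProperties heytingCommutativeRing

  𝓡 : CommutativeRing c ℓ₁
  𝓡 = HeytingCommutativeRing.commutativeRing heytingCommutativeRing

  module R = CommutativeRing 𝓡
  open RingProperties R.ring using (-‿distribˡ-*; -‿distribʳ-*; -‿+-comm; -1*x≈-x)
  open GroupProperties R.+-group using (x∙y⁻¹≈ε⇒x≈y; //-rightDividesˡ; //-rightDividesʳ)
  open Exp R.semiring using () renaming (_^_ to infixr 8 _^ᶠ_)
  open Sum R.*-commutativeMonoid using (sum-cong-≋; sum-replicate; sum-replicate-zero)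
    renaming (sum to product; sum-remove to product-remove; sum-permute to product-permute;
              ∑-distrib-+ to product-distrib-*)
  open CommutativeSemigroupProperties R.*-commutativeSemigroup using ()
    renaming (interchange to *-interchange; xy∙z≈y∙xz to xy*z≈y*xz)
  open SemiringIdentities R.commutativeSemiring
  open SetoidReasoning R.setoid

  _≟_ : Decidable _≈_
  _≟_ = hasOrder⇒≟ sizeL

  -- An inverse of `x` is searched for among the finitely many elements. If there is none, `x` is
  -- not apart from 0, and tightness of apartness gives equality.
  ≈0⊎#0 : ∀ x → x ≈ 0# ⊎ x # 0#
  ≈0⊎#0 x with Fin.any? (λ i → (x * Inverse.from sizeL i) ≟ 1#)
  ... | yes (i , xy≈1) = inj₂ (invertibleʳ⇒# (_ , trans (*-congʳ (x-0≈x x)) xy≈1))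
  ... | no noInverse = inj₁ (proj₁ (tight x 0#) λ x#0 →
    let (y , _ , xy≈1) = #⇒invertible x#0 in
    noInverse (Inverse.to sizeL y ,
      trans (*-congˡ (from-to sizeL y)) (trans (*-congʳ (sym (x-0≈x x))) xy≈1)))

  #⇒≉ : ∀ {x y} → x # y → ¬ (x ≈ y)
  #⇒≉ x#y x≈y = #-irrefl x≈y x#y

  1≉0 : ¬ (1# ≈ 0#)
  1≉0 = #⇒≉ 1#0

  ≉0⇒#0 : ∀ {x} → ¬ (x ≈ 0#) → x # 0#
  ≉0⇒#0 {x} x≉0 with ≈0⊎#0 x
  ... | inj₁ x≈0 = contradiction x≈0 x≉0
  ... | inj₂ x#0 = x#0

  *-cancelʳ : ∀ {x y z} → z # 0# → x * z ≈ y * z → x ≈ y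
  *-cancelʳ {x} {y} {z} z#0 eq = begin
    x                      ≈⟨ *-identityʳ x ⟨
    x * 1#                 ≈⟨ *-congˡ zw≈1 ⟨
    x * ((z - 0#) * w)     ≈⟨ *-congˡ (*-congʳ (x-0≈x z)) ⟩
    x * (z * w)            ≈⟨ *-assoc x z w ⟨
    (x * z) * w            ≈⟨ *-congʳ eq ⟩
    (y * z) * w            ≈⟨ *-assoc y z w ⟩
    y * (z * w)            ≈⟨ *-congˡ (*-congʳ (x-0≈x z)) ⟨
    y * ((z - 0#) * w)     ≈⟨ *-congˡ zw≈1 ⟩
    y * 1#                 ≈⟨ *-identityʳ y ⟩
    y                      ∎
    where
    w = proj₁ (#⇒invertible z#0)
    zw≈1 = proj₂ (proj₂ (#⇒invertible z#0))

  *-cancelˡ : ∀ {x y z} → z # 0# → z * x ≈ z * y → x ≈ y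
  *-cancelˡ z#0 eq = *-cancelʳ z#0 (trans (*-comm _ _) (trans eq (*-comm _ _)))

  x*y≈0⇒y≈0 : ∀ {x y} → x # 0# → x * y ≈ 0# → y ≈ 0#
  x*y≈0⇒y≈0 x#0 eq = *-cancelˡ x#0 (trans eq (sym (zeroʳ _)))

  -- For the elements of a subfield this is `subsetoid` by definition, so subfields and spans are
  -- counted in the same way.
  subset : ∀ {u} → Pred Carrier u → Setoid (c ⊔ u) ℓ₁
  subset U = On.setoid setoid (proj₁ {B = U})

  Respects : ∀ {u} → Pred Carrier u → Set (c ⊔ ℓ₁ ⊔ u)
  Respects U = ∀ {x y} → x ≈ y → x ∈ U → y ∈ U

  module _ {u m} {U : Pred Carrier u} (resp : Respects U) (size : HasOrder (subset U) m) where

    ∈? : ∀ x → Dec (x ∈ U)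
    ∈? x = map′
      (λ (i , eq) → resp eq (proj₂ (Inverse.from size i)))
      (λ x∈U → Inverse.to size (x , x∈U) , from-to size (x , x∈U))
      (Fin.any? (λ i → proj₁ (Inverse.from size i) ≟ x))

    -- The inclusion is an injection between finite sets of equal order, hence onto.
    ⊆⇒⊇ : ∀ {v} {V : Pred Carrier v} → HasOrder (subset V) m → U ⊆ V → V ⊆ U
    ⊆⇒⊇ sizeV U⊆V {y} y∈V with injective⇒surjective-setoid size sizeV
        {f = λ (x , x∈U) → x , U⊆V x∈U} (λ eq → eq) (λ eq → eq) (y , y∈V)
    ... | (x , x∈U) , x≈y = resp x≈y x∈U

  -- Fermat's little theorem for multiplicatively closed subsets.

  -- g replaces 0 by 1, so that the product of all g k is invertible.  Reindexing
  -- this product along k ↦ x k multiplies it by x for each k ≉ 0; h supplies the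
  -- factor x missing at k ≈ 0.
  module Fermat {u m} {K : Pred Carrier u} (0∈K : 0# ∈ K)
                (*-closed : ∀ {x y} → x ∈ K → y ∈ K → x * y ∈ K)
                (size : HasOrder (subset K) (suc m))
                {x} (x∈K : x ∈ K) (x#0 : x # 0#) where

    open Inverse size using (to; from; to-cong)

    e : Fin (suc m) → Carrier
    e i = proj₁ (from i)

    g : Carrier → Carrier
    g y with y ≟ 0#
    ... | yes _ = 1#
    ... | no  _ = y

    h : Carrier → Carrier
    h y with y ≟ 0#
    ... | yes _ = x
    ... | no  _ = 1#

    g-cong : ∀ {y z} → y ≈ z → g y ≈ g z
    g-cong {y} {z} y≈z with y ≟ 0# | z ≟ 0#
    ... | yes _   | yes _   = refl
    ... | yes y≈0 | no  z≉0 = contradiction (trans (sym y≈z) y≈0) z≉0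
    ... | no  y≉0 | yes z≈0 = contradiction (trans y≈z z≈0) y≉0
    ... | no  _   | no  _   = y≈z

    g#0 : ∀ y → g y # 0#
    g#0 y with y ≟ 0#
    ... | yes _   = 1#0
    ... | no  y≉0 = ≉0⇒#0 y≉0

    h*g : ∀ y → h y * g (x * y) ≈ x * g y
    h*g y with y ≟ 0# | (x * y) ≟ 0#
    ... | yes _   | yes _    = refl
    ... | yes y≈0 | no  xy≉0 = contradiction (trans (*-congˡ y≈0) (zeroʳ x)) xy≉0
    ... | no  y≉0 | yes xy≈0 = contradiction (x*y≈0⇒y≈0 x#0 xy≈0) y≉0
    ... | no  _   | no  _    = *-identityˡ _

    product#0 : ∀ {n} (t : Fin n → Carrier) → (∀ i → t i # 0#) → product t # 0#
    product#0 {0}     t t#0 = 1#0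
    product#0 {suc n} t t#0 = x#0y#0→xy#0 (t#0 zero) (product#0 (t ∘ suc) (t#0 ∘ suc))

    -- Multiplication by `x` transported to the indices; cancellation makes it injective, hence a
    -- permutation.
    π : Fin (suc m) → Fin (suc m)
    π i = to (x * e i , *-closed x∈K (proj₂ (from i)))

    e-π : ∀ i → e (π i) ≈ x * e i
    e-π i = from-to size _

    e-injective : ∀ {i k} → e i ≈ e k → i ≡ k
    e-injective {i} {k} eq =
      ≡.trans (≡.sym (to-from size i)) (≡.trans (to-cong eq) (to-from size k))

    π-injective : Injective _≡_ _≡_ π
    π-injective eq = e-injective (*-cancelˡ x#0 (to-injective size eq))

    i₀ : Fin (suc m)
    i₀ = to (0# , 0∈K)

    e-i₀ : e i₀ ≈ 0#
    e-i₀ = from-to size _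

    h-i₀ : h (e i₀) ≈ x
    h-i₀ with e i₀ ≟ 0#
    ... | yes _   = refl
    ... | no  ≉0 = contradiction e-i₀ ≉0

    h-punchIn : ∀ k → h (e (punchIn i₀ k)) ≈ 1#
    h-punchIn k with e (punchIn i₀ k) ≟ 0#
    ... | yes ≈0 = contradiction (e-injective (trans ≈0 (sym e-i₀))) (Fin.punchInᵢ≢i i₀ k)
    ... | no  _  = refl

    -- The enumeration `e` meets 0 only at `i₀`, so every other factor is 1.
    product-h : product (h ∘ e) ≈ x
    product-h = begin
      product (h ∘ e)                                  ≈⟨ product-remove {i = i₀} (h ∘ e) ⟩
      h (e i₀) * product (λ k → h (e (punchIn i₀ k)))  ≈⟨ *-cong h-i₀ (sum-cong-≋ h-punchIn) ⟩
      x * product {m} (λ _ → 1#)                       ≈⟨ *-congˡ (sum-replicate-zero m) ⟩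
      x * 1#                                           ≈⟨ *-identityʳ x ⟩
      x                                                ∎

    x^m≈x : x ^ᶠ suc m ≈ x
    x^m≈x = *-cancelʳ (product#0 (g ∘ e) (g#0 ∘ e)) (begin
      x ^ᶠ suc m * product (g ∘ e)               ≈⟨ *-congʳ (sum-replicate (suc m)) ⟨
      product {suc m} (λ _ → x) * product (g ∘ e) ≈⟨ product-distrib-* (λ _ → x) (g ∘ e) ⟨
      product (λ i → x * g (e i))                ≈⟨ sum-cong-≋ (λ i → h*g (e i)) ⟨
      product (λ i → h (e i) * g (x * e i))      ≈⟨ sum-cong-≋ (λ i → *-congˡ {h (e i)} (g-cong (e-π i))) ⟨
      product (λ i → h (e i) * g (e (π i)))      ≈⟨ product-distrib-* (h ∘ e) (g ∘ e ∘ π) ⟩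
      product (h ∘ e) * product (g ∘ e ∘ π)
        ≈⟨ *-cong product-h (sym (product-permute (g ∘ e) (injective⇒permutation π-injective))) ⟩
      x * product (g ∘ e)                        ∎)

  -- Stated for multiplicatively closed sets so that it applies to ⟨α, 1⟩ before that span is known
  -- to be a field. The exponent is the order of `K` with 0 counted, and the case of `x` equal to 0
  -- is treated apart.
  fermat : ∀ {u m} {K : Pred Carrier u} → 0# ∈ K →
           (∀ {x y} → x ∈ K → y ∈ K → x * y ∈ K) →
           HasOrder (subset K) m → ∀ {x} → x ∈ K → x ^ᶠ m ≈ x
  fermat {m = 0} 0∈K *-closed size x∈K = contradiction (Inverse.to size (_ , x∈K)) λ ()
  fermat {m = suc m} 0∈K *-closed size {x} x∈K with ≈0⊎#0 x
  ... | inj₁ x≈0 = trans (*-congʳ x≈0) (trans (zeroˡ _) (sym x≈0))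
  ... | inj₂ x#0 = Fermat.x^m≈x 0∈K *-closed size x∈K x#0

  -- Monic polynomials and the number of their roots.

  -- The value at x of the monic polynomial p₀ + p₁ X + ⋯ + X^d.
  monic : ∀ {d} → Vec Carrier d → Carrier → Carrier
  monic []      x = 1#
  monic (a ∷ p) x = a + x * monic p x

  -- Horner's scheme: the coefficients of the quotient by X - r are the values at `r` of the
  -- successive tails of the polynomial. The leading 1 stays implicit.
  quotient : ∀ {d} → Vec Carrier (suc d) → Carrier → Vec Carrier d
  quotient (_ ∷ [])      r = []
  quotient (_ ∷ p@(_ ∷ _)) r = monic p r ∷ quotient p r

  monic-division : ∀ {d} (p : Vec Carrier (suc d)) r x →
                   monic p x ≈ (x - r) * monic (quotient p r) x + monic p r
  monic-division (a ∷ []) r x = begin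
    a + x * 1#                        ≈⟨ +-congˡ (*-congʳ (sym (//-rightDividesˡ r x))) ⟩
    a + ((x - r) + r) * 1#            ≈⟨ linear-division a (x - r) r 1# ⟩
    (x - r) * 1# + (a + r * 1#)       ∎
  monic-division (a ∷ p@(_ ∷ _)) r x = begin
    a + x * monic p x                                ≈⟨ +-congˡ (*-congˡ (monic-division p r x)) ⟩
    a + x * ((x - r) * q + v)                        ≈⟨ +-congˡ (distribˡ x _ v) ⟩
    -- Only the `x` multiplying `v` is split as (x - r) + r, the shape that `division-step`
    -- regroups.
    a + (x * ((x - r) * q) + x * v)                  ≈⟨ +-congˡ (+-congˡ (*-congʳ (sym (//-rightDividesˡ r x)))) ⟩
    a + (x * ((x - r) * q) + ((x - r) + r) * v)      ≈⟨ division-step a x (x - r) r q v ⟩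
    (x - r) * (v + x * q) + (a + r * v)              ∎
    where
    q = monic (quotient p r) x
    v = monic p r

  -- Induction on the degree: divide by X - r for the first root `r`. At every other root x - r is
  -- invertible, so that root is also a root of the quotient.
  too-many-roots : ∀ {d} (p : Vec Carrier d) (f : Fin (suc d) → Carrier) →
                   Injective _≡_ _≈_ f → ¬ (∀ i → monic p (f i) ≈ 0#)
  too-many-roots []        f inj roots = 1≉0 (roots zero)
  too-many-roots p@(_ ∷ _) f inj roots =
    too-many-roots (quotient p r) (f ∘ suc) (Fin.suc-injective ∘ inj) λ i →
      x*y≈0⇒y≈0 (f-r#0 i) (begin
        (f (suc i) - r) * monic (quotient p r) (f (suc i))              ≈⟨ +-identityʳ _ ⟨
        (f (suc i) - r) * monic (quotient p r) (f (suc i)) + 0#         ≈⟨ +-congˡ (roots zero) ⟨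
        (f (suc i) - r) * monic (quotient p r) (f (suc i)) + monic p r  ≈⟨ monic-division p r (f (suc i)) ⟨
        monic p (f (suc i))                                             ≈⟨ roots (suc i) ⟩
        0#                                                              ∎)
    where
    r = f zero
    f-r#0 : ∀ i → f (suc i) - r # 0#
    f-r#0 i = ≉0⇒#0 λ eq → contradiction (inj (x∙y⁻¹≈ε⇒x≈y _ _ eq)) λ ()

  monic-0⋯0 : ∀ d x → monic (replicate d 0#) x ≈ x ^ᶠ d
  monic-0⋯0 0       x = refl
  monic-0⋯0 (suc d) x = trans (+-identityˡ _) (*-congˡ (monic-0⋯0 d x))

  -- The coefficient vector is that of X^(d+2) - X. Writing its two lowest coefficients separately
  -- requires an exponent of at least 2, whence the separate cases 0 and 1 in `fixed⇒∈`.
  monic-X^m-X : ∀ {d x} → x ^ᶠ suc (suc d) ≈ x →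
                monic (0# ∷ - 1# ∷ replicate d 0#) x ≈ 0#
  monic-X^m-X {d} {x} eq = begin
    0# + x * (- 1# + x * monic (replicate d 0#) x)  ≈⟨ +-identityˡ _ ⟩
    x * (- 1# + x * monic (replicate d 0#) x)       ≈⟨ *-congˡ (+-congˡ (*-congˡ (monic-0⋯0 d x))) ⟩
    x * (- 1# + x * x ^ᶠ d)                         ≈⟨ distribˡ x _ _ ⟩
    x * - 1# + x ^ᶠ suc (suc d)                     ≈⟨ +-cong (sym (-‿distribʳ-* x 1#)) eq ⟩
    - (x * 1#) + x                                  ≈⟨ +-congʳ (-‿cong (*-identityʳ x)) ⟩
    - x + x                                         ≈⟨ -‿inverseˡ x ⟩
    0#                                              ∎

  -- An `x` outside `K` would, together with the `m` elements of `K`, give m + 1 distinct roots of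
  -- X^m - X. Orders 0 and 1 are impossible because `K` contains the distinct elements 0 and 1.
  fixed⇒∈ : ∀ {k m} (K : Subfield L k) → HasOrder (Subfield.subsetoid K) m →
            ∀ {x} → x ^ᶠ m ≈ x → x ∈ Subfield.elements K
  fixed⇒∈ {m = 0} K size _ = contradiction (Inverse.to size (_ , Subfield.0-closed K)) λ ()
  fixed⇒∈ {m = 1} K size _ =
    contradiction (to-injective size {_ , 1-closed} {_ , 0-closed} (Fin1-prop _ _)) 1≉0
    where
    open Subfield K
    Fin1-prop : (i k : Fin 1) → i ≡ k
    Fin1-prop zero zero = ≡.refl
  fixed⇒∈ {m = suc (suc d)} K size {x} x^m≈x with ∈? (Subfield.resp-≈ K) size x
  ... | yes x∈K = x∈K
  ... | no  x∉K = contradiction (λ i → monic-X^m-X {d} (fixed i))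
                    (too-many-roots (0# ∷ - 1# ∷ replicate d 0#) f f-injective)
    where
    open Subfield K
    open Inverse size using (from; to-cong)

    f : Fin (suc (suc (suc d))) → Carrier
    f zero    = x
    f (suc i) = proj₁ (from i)

    fixed : ∀ i → f i ^ᶠ suc (suc d) ≈ f i
    fixed zero    = x^m≈x
    fixed (suc i) = fermat 0-closed *-closed size (proj₂ (from i))

    f-injective : Injective _≡_ _≈_ f
    f-injective {zero}  {zero}  eq = ≡.refl
    f-injective {zero}  {suc k} eq = contradiction (resp-≈ (sym eq) (proj₂ (from k))) x∉K
    f-injective {suc i} {zero}  eq = contradiction (resp-≈ eq (proj₂ (from i))) x∉K
    f-injective {suc i} {suc k} eq = ≡.cong suc
      (≡.trans (≡.sym (to-from size i)) (≡.trans (to-cong eq) (to-from size k)))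

  -- Fermat's theorem for `U` makes its elements roots of X^m - X, hence elements of `K`; counting
  -- gives the other inclusion.
  sameOrder⇒≐ : ∀ {k m u} (K : Subfield L k) → HasOrder (Subfield.subsetoid K) m →
                {U : Pred Carrier u} → Respects U → 0# ∈ U →
                (∀ {x y} → x ∈ U → y ∈ U → x * y ∈ U) →
                HasOrder (subset U) m → U ≐ Subfield.elements K
  sameOrder⇒≐ K size {U} resp 0∈U closed sizeU = U⊆K , ⊆⇒⊇ resp sizeU size U⊆K
    where
    U⊆K : U ⊆ Subfield.elements K
    U⊆K x∈U = fixed⇒∈ K size (fermat 0∈U closed sizeU x∈U)

  -- Independent pairs, two-dimensional spans and points.

  module Lines {f q} (F : Subfield L f) (sizeF : HasOrder (Subfield.subsetoid F) q) where

    open PG L F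
    open Subfield F

    Independent⇒#0ˡ : ∀ {a b} → Independent a b → a # 0#
    Independent⇒#0ˡ {a} {b} ind = ≉0⇒#0 λ a≈0 → 1≉0 (proj₁ (ind 1-closed 0-closed (begin
      1# * a + 0# * b  ≈⟨ +-cong (*-congˡ a≈0) (zeroˡ b) ⟩
      1# * 0# + 0#     ≈⟨ +-identityʳ _ ⟩
      1# * 0#          ≈⟨ zeroʳ 1# ⟩
      0#               ∎)))

    Independent-swap : ∀ {a b} → Independent a b → Independent b a
    Independent-swap ind s∈F t∈F eq =
      let t≈0 , s≈0 = ind t∈F s∈F (trans (+-comm _ _) eq) in s≈0 , t≈0

    Independent⇒#0ʳ : ∀ {a b} → Independent a b → b # 0#
    Independent⇒#0ʳ ind = Independent⇒#0ˡ (Independent-swap ind)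

    -- A relation between `a` and `b`, multiplied by `e`, becomes one between `a′` and `b′` with the
    -- same coefficients.
    Independent-descale : ∀ {a b a′ b′ e} → a′ ≈ e * a → b′ ≈ e * b →
                          Independent a′ b′ → Independent a b
    Independent-descale {a} {b} {a′} {b′} {e} a′≈ b′≈ ind {s} {t} s∈F t∈F eq = ind s∈F t∈F (begin
      s * a′ + t * b′            ≈⟨ +-cong (*-congˡ a′≈) (*-congˡ b′≈) ⟩
      s * (e * a) + t * (e * b)  ≈⟨ scale-combination e s t a b ⟩
      e * (s * a + t * b)        ≈⟨ *-congˡ eq ⟩
      e * 0#                     ≈⟨ zeroʳ e ⟩
      0#                         ∎)

    coefficients-unique : ∀ {a b s t s′ t′} → Independent a b →
      s ∈ elements → t ∈ elements → s′ ∈ elements → t′ ∈ elements →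
      s * a + t * b ≈ s′ * a + t′ * b → s ≈ s′ × t ≈ t′
    coefficients-unique {a} {b} {s} {t} {s′} {t′} ind s∈F t∈F s′∈F t′∈F eq =
      let s-s′≈0 , t-t′≈0 = ind (+-closed s∈F (neg-closed s′∈F)) (+-closed t∈F (neg-closed t′∈F)) vanish
      in x∙y⁻¹≈ε⇒x≈y _ _ s-s′≈0 , x∙y⁻¹≈ε⇒x≈y _ _ t-t′≈0
      where
      vanish : (s - s′) * a + (t - t′) * b ≈ 0#
      vanish = begin
        (s - s′) * a + (t - t′) * b
          ≈⟨ add-combinations s (- s′) t (- t′) a b ⟩
        (s * a + t * b) + (- s′ * a + - t′ * b)
          ≈⟨ +-cong eq (+-cong (sym (-‿distribˡ-* s′ a)) (sym (-‿distribˡ-* t′ b))) ⟩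
        (s′ * a + t′ * b) + (- (s′ * a) - t′ * b)  ≈⟨ +-congˡ (-‿+-comm _ _) ⟩
        (s′ * a + t′ * b) - (s′ * a + t′ * b)      ≈⟨ -‿inverseʳ _ ⟩
        0#                                         ∎

    -- Coordinates identify the span with F × F. They are read off from the membership proof, while
    -- equality compares only the vectors; uniqueness of coefficients makes `to` well defined.
    span-order : ∀ {a b} → Independent a b → HasOrder (subset (span a b)) (q *ℕ q)
    span-order {a} {b} ind = record
      { to        = to
      ; from      = vector ∘ remQuot q
      ; to-cong   = λ {y} {z} → to-cong {y} {z}
      ; from-cong = λ i≡k → reflexive (≡.cong (proj₁ ∘ vector ∘ remQuot q) i≡k)
      ; inverse   = (λ {i} {y} → to-vector i {y}) , λ {y} → vector-to {y}
      }
      where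
      module F = Inverse sizeF

      SpanVector : Set _
      SpanVector = Setoid.Carrier (subset (span a b))

      vector : Fin q × Fin q → SpanVector
      vector (i , k) = _ , proj₁ (F.from i) , proj₁ (F.from k) ,
        proj₂ (F.from i) , proj₂ (F.from k) , refl

      to : SpanVector → Fin (q *ℕ q)
      to (_ , s , t , s∈F , t∈F , _) = combine (F.to (s , s∈F)) (F.to (t , t∈F))

      to-cong : ∀ {y z} → proj₁ y ≈ proj₁ z → to y ≡ to z
      to-cong {_ , s , t , s∈F , t∈F , y≈} {_ , s′ , t′ , s′∈F , t′∈F , z≈} y≈z =
        let s≈s′ , t≈t′ = coefficients-unique ind s∈F t∈F s′∈F t′∈F
                            (trans (sym y≈) (trans y≈z z≈))
        in ≡.cong₂ combine (F.to-cong {s , s∈F} {s′ , s′∈F} s≈s′)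
                           (F.to-cong {t , t∈F} {t′ , t′∈F} t≈t′)

      to-vector : ∀ i {y} → proj₁ y ≈ proj₁ (vector (remQuot q i)) → to y ≡ i
      to-vector i {y} y≈ = ≡.trans (to-cong {y} {vector (remQuot q i)} y≈)
        (≡.trans (≡.cong₂ combine (to-from sizeF _) (to-from sizeF _))
                 (Fin.combine-remQuot {q} q i))

      vector-to : ∀ {y i} → i ≡ to y → proj₁ (vector (remQuot q i)) ≈ proj₁ y
      vector-to {_ , s , t , s∈F , t∈F , y≈} ≡.refl = trans
        (reflexive (≡.cong (proj₁ ∘ vector)
          (Fin.remQuot-combine (F.to (s , s∈F)) (F.to (t , t∈F)))))
        (trans (+-cong (*-congʳ (from-to sizeF (s , s∈F))) (*-congʳ (from-to sizeF (t , t∈F))))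
               (sym y≈))

    module Span a b = IsSubspace (span-isSubspace a b)

    ∈-spanˡ : ∀ {a b} → a ∈ span a b
    ∈-spanˡ {a} {b} = 1# , 0# , 1-closed , 0-closed ,
      sym (trans (+-cong (*-identityˡ a) (zeroˡ b)) (+-identityʳ a))

    ∈-spanʳ : ∀ {a b} → b ∈ span a b
    ∈-spanʳ {a} {b} = 0# , 1# , 0-closed , 1-closed ,
      sym (trans (+-cong (zeroˡ a) (*-identityˡ b)) (+-identityˡ b))

    span-⊆ : ∀ {u a b} {U : Pred Carrier u} → IsSubspace U → a ∈ U → b ∈ U → span a b ⊆ U
    span-⊆ sub a∈U b∈U (_ , _ , s∈F , t∈F , y≈) =
      respects (sym y≈) (+-mem (scale s∈F a∈U) (scale t∈F b∈U))
      where open IsSubspace sub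

    -- Counting takes the place of the exchange lemma: both spans have q² elements, so the inclusion
    -- of `span a b` in `span c d` is an equality.
    exchange : ∀ {a b c d} → Independent a b → Independent c d →
               a ∈ span c d → b ∈ span c d → span c d ⊆ span a b
    exchange {a} {b} {c} {d} ind ind′ a∈ b∈ =
      ⊆⇒⊇ (Span.respects a b) (span-order ind) (span-order ind′)
        (span-⊆ (span-isSubspace c d) a∈ b∈)

    -- Subtraction in a subspace is addition of a multiple by -1, which lies in F.
    +-cancel-∈ : ∀ {u x y} {U : Pred Carrier u} → IsSubspace U → x + y ∈ U → y ∈ U → x ∈ U
    +-cancel-∈ {x = x} {y} sub x+y∈U y∈U = respects
      (trans (+-congˡ (-1*x≈-x y)) (//-rightDividesʳ y x))
      (+-mem x+y∈U (scale (neg-closed 1-closed) y∈U))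
      where open IsSubspace sub

    ∈-points : (ℓ : Line) (P : Point) → rep P ∈ Line.vectors ℓ → P ∈ Line.points ℓ
    ∈-points ℓ P P∈ℓ (_ , s∈F , y≈) = respects (sym y≈) (scale s∈F P∈ℓ)
      where open IsSubspace (Line.isSubspace ℓ)

    rep-∈ : (P : Point) → rep P ∈ Point.subspace P
    rep-∈ P = 1# , 1-closed , sym (*-identityˡ (rep P))

    ≈⇒≈ₚ : ∀ P Q → rep P ≈ rep Q → P ≈ₚ Q
    ≈⇒≈ₚ P Q P≈Q =
      (λ (s , s∈F , y≈) → s , s∈F , trans y≈ (*-congˡ P≈Q)) ,
      (λ (s , s∈F , y≈) → s , s∈F , trans y≈ (*-congˡ (sym P≈Q)))

    inv-unique : ∀ {x y} (x#0 : x # 0#) → x * y ≈ 1# → inv x x#0 ≈ y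
    inv-unique {x} x#0 eq = *-cancelˡ x#0 (trans (inv-inverseʳ x x#0) (sym eq))

    inv-inv : ∀ x (x#0 : x # 0#) (x⁻¹#0 : inv x x#0 # 0#) → inv (inv x x#0) x⁻¹#0 ≈ x
    inv-inv x x#0 x⁻¹#0 = inv-unique x⁻¹#0 (inv-inverseˡ x x#0)

    *-inv-cancel : ∀ x y (y#0 : y # 0#) → (x * inv y y#0) * y ≈ x
    *-inv-cancel x y y#0 =
      trans (*-assoc _ _ _) (trans (*-congˡ (inv-inverseˡ y y#0)) (*-identityʳ x))

    -- The ratio α = a/b and the span ⟨α, 1⟩.

    module Ratio {a b} (ind : Independent a b) (b#0 : b # 0#) where
      private
        a#0 = Independent⇒#0ˡ ind
        a⁻¹ = inv a a#0
        b⁻¹ = inv b b#0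
        α   = a * b⁻¹

      -- Multiplication by ab takes the pair (a⁻¹, b⁻¹) to (b, a).
      Independent-inv : Independent a⁻¹ b⁻¹
      Independent-inv = Independent-descale {e = a * b}
        (sym (trans (*-congʳ (*-comm a b)) (trans (*-assoc _ _ _) (trans (*-congˡ (inv-inverseʳ a a#0)) (*-identityʳ b)))))
        (sym (trans (*-assoc _ _ _) (trans (*-congˡ (inv-inverseʳ b b#0)) (*-identityʳ a))))
        (Independent-swap ind)

      Independent-ratio : Independent α 1#
      Independent-ratio = Independent-descale {e = b}
        (sym (trans (*-comm _ _) (*-inv-cancel a b b#0))) (sym (*-identityʳ b)) ind

      a+b#0 : a + b # 0#
      a+b#0 = ≉0⇒#0 λ eq → 1≉0 (proj₁ (ind 1-closed 1-closed
        (trans (+-cong (*-identityˡ a) (*-identityˡ b)) eq)))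

      inv-sum⇒quadratic : inv (a + b) a+b#0 ∈ span a⁻¹ b⁻¹ → α * α ∈ span α 1#
      inv-sum⇒quadratic (s , t , s∈F , t∈F , p≈) = respects
        (trans (sym (*-assoc _ t _)) (trans (*-congʳ (inv-inverseˡ t t#0)) (*-identityˡ _)))
        (scale (inv-closed (inv-inverseʳ t t#0) t∈F) tα²∈)
        where
        span′ = span-isSubspace α 1#
        open IsSubspace span′

        α≈ : α ≈ (s * α + s * 1#) + (t * (α * α) + t * α)
        α≈ = begin
          α                                              ≈⟨ *-identityʳ α ⟨
          α * 1#                                         ≈⟨ *-congˡ (inv-inverseˡ (a + b) a+b#0) ⟨
          α * (inv (a + b) a+b#0 * (a + b))              ≈⟨ *-congˡ (*-congʳ p≈) ⟩
          (a * b⁻¹) * ((s * a⁻¹ + t * b⁻¹) * (a + b))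
            ≈⟨ clear-denominators a b a⁻¹ b⁻¹ s t ⟩
          ((a * a⁻¹) * (s * α) + s * ((a * a⁻¹) * (b * b⁻¹))) + (t * (α * α) + (b * b⁻¹) * (t * α))
            ≈⟨ +-cong (+-cong (unit a≈1) (*-congˡ (trans (unit a≈1) b≈1))) (+-congˡ (unit b≈1)) ⟩
          (s * α + s * 1#) + (t * (α * α) + t * α)       ∎
          where
          a≈1 = inv-inverseʳ a a#0
          b≈1 = inv-inverseʳ b b#0
          unit : ∀ {x y} → x ≈ 1# → x * y ≈ y
          unit x≈1 = trans (*-congʳ x≈1) (*-identityˡ _)

        -- With t = 0 the relation would read α = sα + s, and comparing coefficients would force
        -- both s = 1 and s = 0.
        t≉0 : ¬ (t ≈ 0#)
        t≉0 t≈0 = 1≉0 (trans (proj₁ s≈) (sym (proj₂ s≈)))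
          where
          s≈ : 1# ≈ s × 0# ≈ s
          s≈ = coefficients-unique Independent-ratio 1-closed 0-closed s∈F s∈F (begin
            1# * α + 0# * 1#                           ≈⟨ +-cong (*-identityˡ α) (zeroˡ 1#) ⟩
            α + 0#                                     ≈⟨ +-identityʳ α ⟩
            α                                          ≈⟨ α≈ ⟩
            (s * α + s * 1#) + (t * (α * α) + t * α)   ≈⟨ +-congˡ (+-cong (vanish _) (vanish α)) ⟩
            (s * α + s * 1#) + (0# + 0#)               ≈⟨ +-congˡ (+-identityˡ 0#) ⟩
            (s * α + s * 1#) + 0#                      ≈⟨ +-identityʳ _ ⟩
            s * α + s * 1#                             ∎)
            where
            vanish : ∀ x → t * x ≈ 0#
            vanish x = trans (*-congʳ t≈0) (zeroˡ x)

        t#0 = ≉0⇒#0 t≉0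

        tα²∈ : t * (α * α) ∈ span α 1#
        -- Since α itself lies in the span, so does the right side of `α≈`; removing first sα + s
        -- and then tα leaves tα².
        tα²∈ = +-cancel-∈ span′
          (+-cancel-∈ span′
            (respects (trans α≈ (+-comm _ _)) ∈-spanˡ)
            (s , s , s∈F , s∈F , refl))
          (scale t∈F ∈-spanˡ)

      -- The images of the three points Fa, Fb and F(a + b) lie on `m`. The first two already span
      -- `m`, so (a + b)⁻¹ is a combination of a⁻¹ and b⁻¹.
      isLine⇒quadratic : (ℓ : Line) → Line.vectors ℓ ≐ span a b →
                         IsLine (jImage ℓ) → α * α ∈ span α 1#
      isLine⇒quadratic ℓ (_ , span⊆ℓ) (m , jℓ⊆m , _) with Line.basis m
      ... | c , d , ind′ , m⊆span , _ = inv-sum⇒quadratic (exchange Independent-inv ind′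
              (inverted a#0 (span⊆ℓ ∈-spanˡ))
              (inverted b#0 (span⊆ℓ ∈-spanʳ))
              (inverted a+b#0 (span⊆ℓ (Span.+-mem a b ∈-spanˡ ∈-spanʳ))))
        where
        inverted : ∀ {y} (y#0 : y # 0#) → y ∈ Line.vectors ℓ → inv y y#0 ∈ span c d
        inverted {y} y#0 y∈ℓ = m⊆span (jℓ⊆m {j Q} (Q , ∈-points ℓ Q y∈ℓ , (λ z → z) , (λ z → z)) (rep-∈ (j Q)))
          where Q = point y y#0

      module _ {k} (C : Subfield L k) (sizeC : HasOrder (Subfield.subsetoid C) (q *ℕ q)) where
        private module C = Subfield C

        -- The relation α² = uα + v brings products of elements of ⟨α, 1⟩ back into it, and ⟨α, 1⟩
        -- has as many elements as `C`.
        quadratic⇒≐ : α * α ∈ span α 1# → span α 1# ≐ C.elements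
        quadratic⇒≐ (u , v , u∈F , v∈F , α²≈) =
          sameOrder⇒≐ C sizeC (Span.respects α 1#) (Span.0-mem α 1#) closed (span-order Independent-ratio)
          where
          closed : ∀ {x y} → x ∈ span α 1# → y ∈ span α 1# → x * y ∈ span α 1#
          closed {x} {y} (s , t , s∈F , t∈F , x≈) (s′ , t′ , s′∈F , t′∈F , y≈) =
            s * s′ * u + (s * t′ + t * s′) , s * s′ * v + t * t′ ,
            +-closed (*-closed (*-closed s∈F s′∈F) u∈F) (+-closed (*-closed s∈F t′∈F) (*-closed t∈F s′∈F)) ,
            +-closed (*-closed (*-closed s∈F s′∈F) v∈F) (*-closed t∈F t′∈F) ,
            (begin
              x * y                                ≈⟨ *-cong x≈ y≈ ⟩
              (s * α + t * 1#) * (s′ * α + t′ * 1#)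
                ≈⟨ *-cong (+-congˡ (*-identityʳ t)) (+-congˡ (*-identityʳ t′)) ⟩
              (s * α + t) * (s′ * α + t′)
                ≈⟨ multiply-linear α s t s′ t′ ⟩
              s * s′ * (α * α) + ((s * t′ + t * s′) * α + t * t′)
                ≈⟨ +-congʳ (*-congˡ (trans α²≈ (+-congˡ (*-identityʳ v)))) ⟩
              s * s′ * (u * α + v) + ((s * t′ + t * s′) * α + t * t′)
                ≈⟨ collect-linear α u v (s * s′) (s * t′ + t * s′) (t * t′) ⟩
              (s * s′ * u + (s * t′ + t * s′)) * α + (s * s′ * v + t * t′)
                ≈⟨ +-congˡ (*-identityʳ _) ⟨
              (s * s′ * u + (s * t′ + t * s′)) * α + (s * s′ * v + t * t′) * 1#  ∎)

        -- Multiplication by `b` carries ⟨α, 1⟩ onto ⟨a, b⟩.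
        ≐⇒spread : span α 1# ≐ C.elements → (ℓ : Line) → Line.vectors ℓ ≐ span a b →
                   ℓ ∈ DesarguesianSpread C
        ≐⇒spread (span⊆C , C⊆span) ℓ (ℓ⊆span , span⊆ℓ) = b , b#0 , ⊆Cb ∘ ℓ⊆span , span⊆ℓ ∘ Cb⊆
          where
          factor : ∀ s t → s * a + t * b ≈ (s * α + t * 1#) * b
          factor s t = sym (begin
            (s * α + t * 1#) * b      ≈⟨ distribʳ b _ _ ⟩
            s * α * b + t * 1# * b    ≈⟨ +-cong (*-assoc s α b) (*-congʳ (*-identityʳ t)) ⟩
            s * (α * b) + t * b       ≈⟨ +-congʳ (*-congˡ (*-inv-cancel a b b#0)) ⟩
            s * a + t * b             ∎)

          ⊆Cb : span a b ⊆ C.elements · b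
          ⊆Cb (s , t , s∈F , t∈F , y≈) =
            s * α + t * 1# , span⊆C (s , t , s∈F , t∈F , refl) , trans y≈ (factor s t)

          Cb⊆ : C.elements · b ⊆ span a b
          Cb⊆ (z , z∈C , y≈) with C⊆span z∈C
          ... | s , t , s∈F , t∈F , z≈ =
            s , t , s∈F , t∈F , trans y≈ (trans (*-congʳ z≈) (sym (factor s t)))

        ≐⇒Adjoin≐ : span α 1# ≐ C.elements → Adjoin α ≐ C.elements
        ≐⇒Adjoin≐ (span⊆C , C⊆span) = adjoin⊆ , span⊆adjoin ∘ C⊆span
          where
          adjoin⊆ : Adjoin α ⊆ C.elements
          -- The inclusion of F in `C` comes from that of F in ⟨α, 1⟩, by x = 0α + x1.
          adjoin⊆ (base {x} x∈F) = span⊆C (0# , x , 0-closed , x∈F ,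
            sym (trans (+-cong (zeroˡ α) (*-identityʳ x)) (+-identityˡ x)))
          adjoin⊆ gen            = span⊆C ∈-spanˡ
          adjoin⊆ (resp x≈y p)   = C.resp-≈ x≈y (adjoin⊆ p)
          adjoin⊆ (add p p′)     = C.+-closed (adjoin⊆ p) (adjoin⊆ p′)
          adjoin⊆ (neg p)        = C.neg-closed (adjoin⊆ p)
          adjoin⊆ (mul p p′)     = C.*-closed (adjoin⊆ p) (adjoin⊆ p′)
          adjoin⊆ (recip eq p)   = C.inv-closed eq (adjoin⊆ p)

          span⊆adjoin : span α 1# ⊆ Adjoin α
          span⊆adjoin (s , t , s∈F , t∈F , y≈) =
            resp (sym y≈) (add (mul (base s∈F) gen) (mul (base t∈F) (base 1-closed)))

        -- The span lies in F(α) = C, and both have q² elements.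
        Adjoin≐⇒≐ : Adjoin α ≐ C.elements → span α 1# ≐ C.elements
        Adjoin≐⇒≐ (adjoin⊆C , _) =
          span⊆C , ⊆⇒⊇ (Span.respects α 1#) (span-order Independent-ratio) sizeC span⊆C
          where
          span⊆C : span α 1# ⊆ C.elements
          span⊆C (s , t , s∈F , t∈F , y≈) = C.resp-≈ (sym y≈)
            (C.+-closed (C.*-closed (adjoin⊆C (base s∈F)) (adjoin⊆C gen))
                        (C.*-closed (adjoin⊆C (base t∈F)) C.1-closed))

    -- Inversion on the cosets of C.

    module _ {k} (C : Subfield L k) where
      private module C = Subfield C

      inv-∈-coset : ∀ {x y} (x#0 : x # 0#) (y#0 : y # 0#) →
                    y ∈ C.elements · x → inv y y#0 ∈ C.elements · inv x x#0
      inv-∈-coset {x} {y} x#0 y#0 (z , z∈C , y≈zx) =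
        w , C.inv-closed zw≈1 z∈C , inv-unique y#0 (begin
          y * (w * inv x x#0)                ≈⟨ *-congˡ (xy*z≈y*xz x _ _) ⟩
          y * (inv y y#0 * (x * inv x x#0))  ≈⟨ *-assoc y _ _ ⟨
          y * inv y y#0 * (x * inv x x#0)    ≈⟨ *-cong (inv-inverseʳ y y#0) (inv-inverseʳ x x#0) ⟩
          1# * 1#                            ≈⟨ *-identityˡ 1# ⟩
          1#                                 ∎)
        where
        -- This is z⁻¹, because y = zx; it lies in `C` as the inverse of an element of `C`.
        w = x * inv y y#0
        zw≈1 : z * w ≈ 1#
        zw≈1 = begin
          z * (x * inv y y#0)  ≈⟨ *-assoc z x _ ⟨
          z * x * inv y y#0    ≈⟨ *-congʳ y≈zx ⟨
          y * inv y y#0        ≈⟨ inv-inverseʳ y y#0 ⟩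
          1#                   ∎

      -- j maps the points of C x to those of C x⁻¹ = x⁻² (C x).
      spread⇒isLine : (ℓ : Line) → ℓ ∈ DesarguesianSpread C → IsLine (jImage ℓ)
      spread⇒isLine ℓ (x , x#0 , ℓ⊆Cx , Cx⊆ℓ) with Line.basis ℓ
      ... | a , b , ind , ℓ⊆span , span⊆ℓ = m , (λ {P} → jℓ⊆m {P}) , λ {P} → m⊆jℓ {P}
        where
        x⁻¹ = inv x x#0
        x⁻¹#0 = inv#0 x x#0
        -- A `Line` must come with an F-basis. One for C x⁻¹ is obtained by multiplying the given
        -- basis of `ℓ` by e = x⁻²; multiplying back by x² shows its independence.
        e = x⁻¹ * x⁻¹

        x*x*e≈1 : x * x * e ≈ 1#
        x*x*e≈1 = begin
          x * x * (x⁻¹ * x⁻¹)    ≈⟨ *-interchange x x x⁻¹ x⁻¹ ⟩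
          (x * x⁻¹) * (x * x⁻¹)  ≈⟨ *-cong (inv-inverseʳ x x#0) (inv-inverseʳ x x#0) ⟩
          1# * 1#                ≈⟨ *-identityˡ 1# ⟩
          1#                     ∎

        unscale : ∀ y → y ≈ x * x * (e * y)
        unscale y = sym (trans (sym (*-assoc _ e y)) (trans (*-congʳ x*x*e≈1) (*-identityˡ y)))

        m : Line
        m = record
          { vectors    = span (e * a) (e * b)
          ; isSubspace = span-isSubspace (e * a) (e * b)
          ; basis      = e * a , e * b ,
              Independent-descale (unscale a) (unscale b) ind , (λ y∈m → y∈m) , (λ y∈m → y∈m)
          }

        shift : ∀ z → z * x⁻¹ ≈ e * (z * x)
        shift z = sym (begin
          x⁻¹ * x⁻¹ * (z * x)  ≈⟨ *-interchange x⁻¹ x⁻¹ z x ⟩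
          x⁻¹ * z * (x⁻¹ * x)  ≈⟨ *-cong (*-comm x⁻¹ z) (inv-inverseˡ x x#0) ⟩
          z * x⁻¹ * 1#         ≈⟨ *-identityʳ _ ⟩
          z * x⁻¹              ∎)

        Cx⁻¹⊆m : C.elements · x⁻¹ ⊆ span (e * a) (e * b)
        Cx⁻¹⊆m (z , z∈C , y≈) with ℓ⊆span (Cx⊆ℓ (z , z∈C , refl))
        ... | s , t , s∈F , t∈F , zx≈ = s , t , s∈F , t∈F ,
          trans y≈ (trans (shift z) (trans (*-congˡ zx≈) (sym (scale-combination e s t a b))))

        m⊆Cx⁻¹ : span (e * a) (e * b) ⊆ C.elements · x⁻¹
        m⊆Cx⁻¹ (s , t , s∈F , t∈F , y≈) with ℓ⊆Cx (span⊆ℓ (s , t , s∈F , t∈F , refl))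
        ... | z , z∈C , sa+tb≈zx = z , z∈C ,
          trans y≈ (trans (scale-combination e s t a b) (trans (*-congˡ sa+tb≈zx) (sym (shift z))))

        jℓ⊆m : jImage ℓ ⊆ Line.points m
        jℓ⊆m (Q@(point y y#0) , Q∈ℓ , P⊆jQ , _) p∈P =
          ∈-points m (j Q) (Cx⁻¹⊆m (inv-∈-coset x#0 y#0 (ℓ⊆Cx (Q∈ℓ (rep-∈ Q))))) (P⊆jQ p∈P)

        m⊆jℓ : Line.points m ⊆ jImage ℓ
        -- The preimage of `P` is `j P` itself, as `j` is an involution on points.
        m⊆jℓ {P@(point p p#0)} P∈m = j P , ∈-points ℓ (j P) (Cx⊆ℓ p⁻¹∈Cx) ,
          ≈⇒≈ₚ P (j (j P)) (sym (inv-inv p p#0 (inv#0 p p#0)))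
          where
          p⁻¹∈Cx : inv p p#0 ∈ C.elements · x
          p⁻¹∈Cx with inv-∈-coset x⁻¹#0 p#0 (m⊆Cx⁻¹ (P∈m (rep-∈ P)))
          ... | z , z∈C , eq = z , z∈C , trans eq (*-congˡ (inv-inv x x#0 x⁻¹#0))

mainTheorem5 : ∀ {c ℓ₁ ℓ₂ f k} (q n : ℕ) → IsPrimePower q → 2 ≤ n → 2 ∣ n →
    (L : HeytingField c ℓ₁ ℓ₂) → HasOrder (HeytingField.setoid L) (q ^ n) →
    (F : Subfield L f) → HasOrder (Subfield.subsetoid F) q →
    (C : Subfield L k) → HasOrder (Subfield.subsetoid C) (q ^ 2) →
    let open PG L F in
    ((ℓ : Line) → IsLine (jImage ℓ) ⇔ ℓ ∈ DesarguesianSpread C)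
    × ((P Q : Point) (P≠Q : ¬ (P ≈ₚ Q)) →
    IsLine (jImage (lineThrough P Q P≠Q)) ⇔ Adjoin (ratio P Q) ≐ Subfield.elements C)
mainTheorem5 q n _ _ _ L sizeL F sizeF C sizeC =
  (λ ℓ → let (a , b , ind , ℓ≐span) = Line.basis ℓ
             open Ratio ind (Independent⇒#0ʳ ind) in
    mk⇔ (λ line → ≐⇒spread C sizeC′ (quadratic⇒≐ C sizeC′ (isLine⇒quadratic ℓ ℓ≐span line)) ℓ ℓ≐span)
        (spread⇒isLine C ℓ)) ,
  (λ P Q P≠Q → let ℓ = lineThrough P Q P≠Q
                   (_ , _ , ind , ℓ≐span) = Line.basis ℓ
                   -- `inv` depends on the proof of apartness; passing `rep#0 Q` makes the `α` of
                   -- `Ratio` definitionally equal to `ratio P Q`.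
                   open Ratio ind (rep#0 Q) in
    mk⇔ (λ line → ≐⇒Adjoin≐ C sizeC′ (quadratic⇒≐ C sizeC′ (isLine⇒quadratic ℓ ℓ≐span line)))
        (λ adjoin≐C → spread⇒isLine C ℓ
          (≐⇒spread C sizeC′ (Adjoin≐⇒≐ C sizeC′ adjoin≐C) ℓ ℓ≐span)))
  where
  open PG L F
  open FiniteField L sizeL
  open Lines F sizeF

  -- `q ^ 2` unfolds to q(q1), whereas `span-order` counts in the form qq.
  sizeC′ : HasOrder (Subfield.subsetoid C) (q *ℕ q)
  sizeC′ = ≡.subst (HasOrder (Subfield.subsetoid C)) (≡.cong (q *ℕ_) (ℕ.*-identityʳ q)) sizeC
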